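{- Let $p_n=p(n)$ denote the number of partitions of $n$ and $\sigma_n=\sigma(n)$ the sum of the positive divisors of $n$. For every integer $n\ge1$: (i) $n!\,p_n=|J_n(\overline{\sigma})|$; (ii) $\sigma_n=(-1)^{n-1}|H_n(\overline{p})|$; (iii) $p_n=\sum_{|\lambda|=n}z_\lambda^{ -1}\sigma_\lambda$, the sum running over all partitions $\lambda$ of $n$.
   Context: $|M|$ denotes the determinant of a square matrix $M$. For a sequence $\overline{j}=(j_1,j_2,\dots)$, $J_n(\overline{j})$ is the $n\times n$ matrix whose $(i,k)$ entry is $j_{i-k+1}$ for $1\le k\le i\le n$, is $-i$ for $k=i+1$, and is $0$ for $k>i+1$. For a sequence $\overline{h}=(h_0,h_1,h_2,\dots)$ with $h_0=1$, $H_n(\overline{h})$ is the $n\times n$ matrix whose first column has entries $i\,h_i$ ($1\le i\le n$), whose $(i,k)$ entry is $h_{i-k+1}$ for $2\le k\le i$, is $1$ for $k=i+1$, and is $0$ for $k>i+1$. A partition $\lambda$ is a non-increasing sequence $(\lambda_1,\lambda_2,\dots)$ of non-negative integers with finitely many non-zero terms; $|\lambda|=\sum_i\lambda_i$; $m_k(\lambda)$ is the number of parts of $\lambda$ equal to $k$; $z_\lambda=\prod_{k\ge1}k^{m_k(\lambda)}m_k(\lambda)!$; and $\sigma_\lambda=\prod_i\sigma_{\lambda_i}$, the product being over the positive parts of $\lambda$. Here $p(0)=1$. -}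

module Defs where

open import Data.Bool.Base using (T; if_then_else_; true; false)
open import Data.Fin.Base using (Fin; zero; suc; toℕ; punchIn)
open import Data.Integer.Base as ℤ using (ℤ; 0ℤ; 1ℤ; -1ℤ)
import Data.Integer.Properties as ℤₚ
open import Data.List.Base using (List; []; _∷_; _++_; length; map; filter; foldr; applyUpTo)
open import Data.List.Membership.Propositional using (_∈_)
open import Data.List.Membership.Propositional.Properties using (∈-map⁺; ∈-map⁻; ∈-++⁺ˡ; ∈-++⁺ʳ; ∈-++⁻)
open import Data.List.Properties using (∷-injectiveʳ)
open import Data.List.Relation.Unary.All as All using (All; []; _∷_)
import Data.List.Relation.Unary.All.Properties as Allₚ
open import Data.List.Relation.Unary.AllPairs using ([]; _∷_)
open import Data.List.Relation.Unary.Any using (here)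
open import Data.List.Relation.Unary.Linked as Linked using (Linked; []; [-]; _∷_)
open import Data.List.Relation.Unary.Linked.Properties using (Linked⇒All)
open import Data.List.Relation.Unary.Unique.Propositional using (Unique)
import Data.List.Relation.Unary.Unique.Propositional.Properties as Uniqueₚ
open import Data.Nat.Base using (ℕ; zero; suc; _+_; _*_; _∸_; _^_; _!; _≤_; _≥_; _≤ᵇ_; _≡ᵇ_; z≤n; s≤s; NonZero)
open import Data.Nat.Divisibility using (_∣?_)
open import Data.Nat.ListAction using (sum; product)
open import Data.Nat.ListAction.Properties using (product≢0)
open import Data.Nat.Properties
open import Data.Product.Base using (_×_; _,_)
open import Data.Rational.Base as ℚ using (ℚ; 0ℚ)
open import Data.Sum.Base using (inj₁; inj₂)
open import Data.Empty using (⊥; ⊥-elim)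
open import Data.Unit.Base using (tt)
open import Function.Bundles using (_⇔_; mk⇔)
open import Relation.Binary.PropositionalEquality using (_≡_; refl; sym; trans; cong; subst)
open import Relation.Nullary.Decidable.Core using (yes; no)
open import Algebra.Properties.Monoid.Sum ℤₚ.+-0-monoid using () renaming (sum to Σᶠ)

Matrix : ℕ → Set
Matrix n = Fin n → Fin n → ℤ

-- Cofactor expansion along the first row; punchIn k skips column k.
det : ∀ {n} → Matrix n → ℤ
det {zero}  M = 1ℤ
det {suc n} M =
  Σᶠ λ k → -1ℤ ℤ.^ toℕ k ℤ.* M zero k ℤ.* det λ r c → M (suc r) (punchIn k c)

-- Builds a matrix from a formula in 1-based row and column indices.
fromEntries : (ℕ → ℕ → ℤ) → ∀ n → Matrix n
fromEntries a n r c = a (suc (toℕ r)) (suc (toℕ c))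

-- The value of j at index 0 is never used.
J-entry : (ℕ → ℤ) → ℕ → ℕ → ℤ
J-entry j i k =
  if k ≤ᵇ i then j (suc (i ∸ k)) else
  if k ≡ᵇ suc i then ℤ.- (ℤ.+ i) else
  0ℤ

J : ∀ n → (ℕ → ℤ) → Matrix n
J n j = fromEntries (J-entry j) n

-- The value of h at index 0, which is 1 by convention, is never used either:
-- the superdiagonal, where i - k + 1 = 0, is the literal 1.
H-entry : (ℕ → ℤ) → ℕ → ℕ → ℤ
H-entry h i k =
  if k ≡ᵇ 1 then ℤ.+ i ℤ.* h i else
  if k ≤ᵇ i then h (suc (i ∸ k)) else
  if k ≡ᵇ suc i then 1ℤ else
  0ℤ

H : ∀ n → (ℕ → ℤ) → Matrix n
H n h = fromEntries (H-entry h) n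

[1⋯_] : ℕ → List ℕ
[1⋯ n ] = applyUpTo suc n

σ : ℕ → ℕ
σ n = sum (filter (_∣? n) [1⋯ n ])

-- A partition is represented by the list of its positive parts, i.e. with the
-- infinite tail of zeros dropped.
record IsPartition (n : ℕ) (μ : List ℕ) : Set where
  constructor isPartition
  field
    positive      : All (1 ≤_) μ
    nonIncreasing : Linked _≥_ μ
    total         : sum μ ≡ n

-- The partitions of n with at most ℓ parts, all of them at most m: those with
-- largest part equal to m, followed by those with all parts smaller than m.
boxPartitions : (ℓ m n : ℕ) → List (List ℕ)
boxPartitions ℓ       m       zero        = [] ∷ []
boxPartitions zero    m       (suc n)     = []
boxPartitions (suc ℓ) zero    (suc n)     = []
boxPartitions (suc ℓ) (suc m) n@(suc _)   =
  (if suc m ≤ᵇ n then map (suc m ∷_) (boxPartitions ℓ (suc m) (n ∸ suc m)) else [])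
  ++ boxPartitions (suc ℓ) m n

partitions : ℕ → List (List ℕ)
partitions n = boxPartitions n n n

p : ℕ → ℕ
p n = length (partitions n)

mult : ℕ → List ℕ → ℕ
mult k μ = length (filter (k ≟_) μ)

-- Every part is at most sum μ, so the factors with k > sum μ are all 1.
z : List ℕ → ℕ
z μ = product (map (λ k → k ^ mult k μ * mult k μ !) [1⋯ sum μ ])

z≢0 : ∀ μ → NonZero (z μ)
z≢0 μ = product≢0 (Allₚ.map⁺ (Allₚ.applyUpTo⁺₂ suc (sum μ) λ i →
  m*n≢0 _ _ {{m^n≢0 (suc i) (mult (suc i) μ)}} {{mult (suc i) μ !≢0}}))

σ-parts : List ℕ → ℕ
σ-parts μ = product (map σ μ)

sumℚ : List ℚ → ℚ
sumℚ = foldr ℚ._+_ 0ℚ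

-- The rest shows that partitions n lists each partition of n exactly once.

IsBoxPartition : (ℓ m n : ℕ) → List ℕ → Set
IsBoxPartition ℓ m n μ = IsPartition n μ × length μ ≤ ℓ × All (_≤ m) μ

private
  cons-nonIncreasing : ∀ {x μ} → All (_≤ x) μ → Linked _≥_ μ → Linked _≥_ (x ∷ μ)
  cons-nonIncreasing []        []  = [-]
  cons-nonIncreasing (x≥y ∷ _) lk  = x≥y ∷ lk

  tail≤head : ∀ {x μ} → Linked _≥_ (x ∷ μ) → All (_≤ x) μ
  tail≤head lk with Linked⇒All (λ a b → ≤-trans b a) ≤-refl lk
  ... | _ ∷ rest = rest

  length≤sum : ∀ {μ} → All (1 ≤_) μ → length μ ≤ sum μ
  length≤sum []       = z≤n
  length≤sum (q ∷ qs) = +-mono-≤ q (length≤sum qs)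

  parts≤sum : ∀ μ → All (_≤ sum μ) μ
  parts≤sum []      = []
  parts≤sum (x ∷ μ) = m≤m+n x _ ∷ All.map (λ q → ≤-trans q (m≤n+m _ x)) (parts≤sum μ)

boxPartitions-sound : ∀ ℓ m n {μ} → μ ∈ boxPartitions ℓ m n → IsBoxPartition ℓ m n μ
boxPartitions-sound ℓ m zero (here refl) = isPartition [] [] refl , z≤n , []
boxPartitions-sound (suc ℓ) (suc m) n@(suc _) μ∈
  with suc m ≤ᵇ n in eq
... | false with boxPartitions-sound (suc ℓ) m n μ∈
...   | part , len , bnd = part , len , All.map m≤n⇒m≤1+n bnd
boxPartitions-sound (suc ℓ) (suc m) n@(suc _) μ∈ | true
  with ∈-++⁻ (map (suc m ∷_) (boxPartitions ℓ (suc m) (n ∸ suc m))) μ∈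
... | inj₂ μ∈ʳ with boxPartitions-sound (suc ℓ) m n μ∈ʳ
...   | part , len , bnd = part , len , All.map m≤n⇒m≤1+n bnd
boxPartitions-sound (suc ℓ) (suc m) n@(suc _) μ∈ | true | inj₁ μ∈ˡ
  with ∈-map⁻ (suc m ∷_) μ∈ˡ
... | ν , ν∈ , refl with boxPartitions-sound ℓ (suc m) (n ∸ suc m) ν∈
...   | isPartition pos dec tot , len , bnd =
  isPartition (s≤s z≤n ∷ pos) (cons-nonIncreasing bnd dec)
    (trans (cong (suc m +_) tot) (m+[n∸m]≡n (≤ᵇ⇒≤ (suc m) n (subst T (sym eq) tt))))
  , s≤s len , ≤-refl ∷ bnd

boxPartitions-complete : ∀ ℓ m n {μ} → IsBoxPartition ℓ m n μ → μ ∈ boxPartitions ℓ m n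
boxPartitions-complete ℓ m zero {[]} _ = here refl
boxPartitions-complete ℓ m zero {zero ∷ μ} (isPartition (() ∷ _) _ _ , _)
boxPartitions-complete ℓ m zero {suc x ∷ μ} (isPartition _ _ () , _)
boxPartitions-complete ℓ m (suc n) {[]} (isPartition _ _ () , _)
boxPartitions-complete (suc ℓ) zero (suc n) {zero ∷ μ} (isPartition (() ∷ _) _ _ , _)
boxPartitions-complete (suc ℓ) zero (suc n) {suc x ∷ μ} (_ , _ , () ∷ _)
boxPartitions-complete (suc ℓ) (suc m) n@(suc _) {x ∷ μ}
  (part@(isPartition (_ ∷ pos) dec tot) , len@(s≤s len′) , bnd@(x≤ ∷ _))
  with x ≟ suc m
... | no x≢ = ∈-++⁺ʳ _ (boxPartitions-complete (suc ℓ) m n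
        (part , len , x≤m ∷ All.map (λ q → ≤-trans q x≤m) (tail≤head dec)))
  where x≤m = ≤-pred (≤∧≢⇒< x≤ x≢)
... | yes refl with suc m ≤ᵇ n | ≤⇒≤ᵇ (subst (suc m ≤_) tot (m≤m+n (suc m) (sum μ)))
...   | true | _ = ∈-++⁺ˡ (∈-map⁺ (suc m ∷_) (boxPartitions-complete ℓ (suc m) (n ∸ suc m)
        (isPartition pos (Linked.tail dec) tot′ , len′ , tail≤head dec)))
  where tot′ = trans (sym (m+n∸m≡n (suc m) (sum μ))) (cong (_∸ suc m) tot)

boxPartitions-unique : ∀ ℓ m n → Unique (boxPartitions ℓ m n)
boxPartitions-unique ℓ       m       zero      = [] ∷ []
boxPartitions-unique zero    m       (suc n)   = []
boxPartitions-unique (suc ℓ) zero    (suc n)   = []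
boxPartitions-unique (suc ℓ) (suc m) n@(suc _) with suc m ≤ᵇ n
... | false = boxPartitions-unique (suc ℓ) m n
... | true  = Uniqueₚ.++⁺
  (Uniqueₚ.map⁺ ∷-injectiveʳ (boxPartitions-unique ℓ (suc m) (n ∸ suc m)))
  (boxPartitions-unique (suc ℓ) m n)
  λ (μ∈ˡ , μ∈ʳ) → disjoint μ∈ˡ μ∈ʳ
  where
  disjoint : ∀ {μ} → μ ∈ map (suc m ∷_) (boxPartitions ℓ (suc m) (n ∸ suc m)) →
             μ ∈ boxPartitions (suc ℓ) m n → ⊥
  disjoint μ∈ˡ μ∈ʳ with ∈-map⁻ (suc m ∷_) μ∈ˡ
  ... | _ , _ , refl with boxPartitions-sound (suc ℓ) m n μ∈ʳ
  ...   | _ , _ , m<m ∷ _ = ⊥-elim (1+n≰n m<m)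

∈-partitions : ∀ n μ → μ ∈ partitions n ⇔ IsPartition n μ
∈-partitions n μ = mk⇔
  (λ μ∈ → let part , _ = boxPartitions-sound n n n μ∈ in part)
  λ { part@(isPartition pos _ refl) →
        boxPartitions-complete n n n (part , length≤sum pos , parts≤sum μ) }

partitions-unique : ∀ n → Unique (partitions n)
partitions-unique n = boxPartitions-unique n n n

{-# OPTIONS --safe #-}

-- Both p(n) and Q(n) = Σ_{λ ⊢ n} σ_λ / z_λ satisfy n a(n) = Σ_{d=1}^n σ(d) a(n-d), a(0) = 1.
-- Indeed, n Σ_{λ ⊢ n} w(λ) = Σ_k k Σ_{λ ⊢ n} m_k(λ) w(λ), only the λ that contain k contribute to
-- the inner sum, and inserting a part k maps the partitions μ of n-k bijectively onto these λ, with
-- m_k(λ) = m_k(μ) + 1. For w(λ) = σ_λ / z_λ this gives k m_k(λ) w(λ) = σ_k w(μ); for w = 1 it gives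
-- Σ_{λ ⊢ n} m_k(λ) = Σ_{k ∣ d ≤ n} p(n-d).
--
-- A Hessenberg determinant is evaluated from the top: expanding along the first row (c, b, 0, …, 0)
-- and merging the first two columns x, y into c y - b x leaves a Hessenberg determinant of size one
-- less. After r steps the first column is r! Σ_{s ≤ r} p(s) σ(i-s) in the case of J and
-- (-1)^r (i p(i) - Σ_{d ≤ r} σ(d) p(i-d)) in the case of H; by the recurrence the top entries, i = r+1,
-- are (r+1)! p(r+1) and (-1)^r σ(r+1).

module Submission where

open import Defs
open import Algebra.Bundles using (CommutativeMonoid)
open import Data.Bool.Base using (if_then_else_; true; false)
open import Data.Bool.Properties using (T-≡)
open import Data.Fin.Base using (Fin; zero; suc; toℕ; punchIn)
open import Data.Integer.Base as ℤ using (ℤ; 0ℤ; 1ℤ; -1ℤ)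
import Data.Integer.Properties as ℤ
open import Data.Integer.Tactic.RingSolver using () renaming (solve-∀ to ℤ-solve-∀)
open import Data.List.Base using (List; []; _∷_; [_]; _++_; _∷ʳ_; map; filter; foldr; length; applyUpTo; upTo)
open import Data.List.Membership.DecPropositional using () renaming (_∈?_ to ∈?)
open import Data.List.Membership.Propositional using (_∈_; _∉_)
open import Data.List.Membership.Propositional.Properties
  using (∈-applyUpTo⁻; ∈-upTo⁻; ∈-map⁺; ∈-map⁻; ∈-filter⁺; ∈-filter⁻; ∈-∃++)
open import Data.List.Membership.Propositional.Properties.WithK using (unique∧set⇒bag)
open import Data.List.Properties using (applyUpTo-∷ʳ; map-upTo; map-id; filter-accept; filter-reject; filter-none)
open import Data.List.Relation.Binary.BagAndSetEquality using (∼bag⇒↭)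
open import Data.List.Relation.Binary.Permutation.Propositional as Perm
  using (_↭_; ↭-trans; ↭-sym; ↭-reflexive; ↭⇒↭ₛ)
open import Data.List.Relation.Binary.Permutation.Propositional.Properties
  using (All-resp-↭; ∈-resp-↭; ↭-length; filter-↭; map⁺; drop-∷; shift)
open import Data.List.Relation.Binary.Pointwise using (Pointwise-≡⇒≡)
open import Data.List.Relation.Unary.All as All using (All; []; _∷_)
open import Data.List.Relation.Unary.AllPairs using ([]; _∷_)
open import Data.List.Relation.Unary.Any using (here; there)
open import Data.List.Relation.Unary.Linked using (Linked)
open import Data.List.Relation.Unary.Sorted.TotalOrder.Properties using (↗↭↗⇒≋)
open import Data.List.Relation.Unary.Unique.Propositional using (Unique)
import Data.List.Relation.Unary.Unique.Propositional.Properties as Unique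
open import Data.Nat.Base
  using (ℕ; zero; suc; _+_; _*_; _^_; _!; _∸_; _≤_; _<_; _≥_; _≤ᵇ_; _≡ᵇ_; z≤n; s≤s; z<s; s<s; NonZero; >-nonZero)
open import Data.Nat.Divisibility using (_∣?_; ∣⇒≤; ∣-refl; ∣m+n∣m⇒∣n; ∣m∣n⇒∣m+n)
open import Data.Nat.Induction using (<-rec)
open import Data.Nat.ListAction using (sum)
open import Data.Nat.ListAction.Properties using (sum-↭; product-↭)
open import Data.Nat.Properties
open import Data.Nat.Tactic.RingSolver using (solve-∀)
open import Data.Product.Base using (_×_; _,_; ∃)
open import Data.Rational.Base as ℚ using (ℚ)
import Data.Rational.Properties as ℚ
open import Data.Rational.Unnormalised.Base using (mkℚᵘ; *≡*)
import Data.Rational.Unnormalised.Properties as ℚᵘ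
open import Data.Unit.Base using (tt)
open import Function.Base using (_∘_)
open import Function.Bundles using (Equivalence; mk⇔)
open import Level using (Level)
open import Relation.Binary.Bundles using (DecTotalOrder)
open import Relation.Binary.Properties.DecTotalOrder ≤-decTotalOrder using (≥-decTotalOrder)
open import Relation.Binary.PropositionalEquality
  using (_≡_; _≢_; refl; sym; trans; cong; cong₂; subst; module ≡-Reasoning)
open import Relation.Nullary.Decidable using (does; yes; no; does-⇔; dec-true; dec-false)
open import Relation.Nullary.Negation.Core using (¬_; contradiction)
open import Relation.Unary using (Decidable)

open import Algebra.Properties.CommutativeMonoid.Mult +-0-commutativeMonoid using () renaming (_×_ to _·ℕ_)
open import Algebra.Properties.CommutativeMonoid.Mult ℚ.+-0-commutativeMonoid
  using () renaming (_×_ to _·ℚ_; ×-assocˡ to ·ℚ-assocˡ)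
open import Algebra.Properties.Monoid.Sum ℤ.+-0-monoid using (sum-cong-≗; sum-replicate-zero) renaming (sum to Σᶠ)
open import Data.List.Sort.InsertionSort.Base ≥-decTotalOrder using (insert; sort)
open import Data.List.Sort.InsertionSort.Properties ≥-decTotalOrder using (insert-↭; insert-↗; sort-↭; sort-↗)

-- Sums over lists in a commutative monoid

∈-[1⋯]⁻ : ∀ {n k} → k ∈ [1⋯ n ] → 1 ≤ k × k ≤ n
∈-[1⋯]⁻ k∈ with ∈-applyUpTo⁻ suc k∈
... | _ , i<n , refl = s≤s z≤n , i<n

private variable
  a b : Level
  A : Set a
  B : Set b

-- The monoid is left open because the same rearrangements serve sums in ℕ, sums in ℚ and the
-- product that defines `z`.
module ListSum {c ℓ} (M : CommutativeMonoid c ℓ) where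

  open CommutativeMonoid M renaming (refl to ≈-refl; sym to ≈-sym; trans to ≈-trans)
  open import Algebra.Properties.CommutativeSemigroup commutativeSemigroup
    using (x∙yz≈y∙xz; interchange)
  open import Algebra.Properties.CommutativeMonoid.Mult M
    using (×-homo-+) renaming (_×_ to _·_)
  open import Relation.Binary.Reasoning.Setoid setoid

  ∑ : List A → (A → Carrier) → Carrier
  ∑ xs f = foldr _∙_ ε (map f xs)

  ∑-cong : ∀ (xs : List A) {f g} → (∀ {x} → x ∈ xs → f x ≈ g x) → ∑ xs f ≈ ∑ xs g
  ∑-cong []       f≈g = ≈-refl
  ∑-cong (x ∷ xs) f≈g = ∙-cong (f≈g (here refl)) (∑-cong xs (f≈g ∘ there))

  ∑-ε : ∀ (xs : List A) → ∑ xs (λ _ → ε) ≈ ε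
  ∑-ε []       = ≈-refl
  ∑-ε (x ∷ xs) = ≈-trans (identityˡ _) (∑-ε xs)

  ∑-zero : ∀ (xs : List A) {f} → (∀ {x} → x ∈ xs → f x ≈ ε) → ∑ xs f ≈ ε
  ∑-zero xs f≈ε = ≈-trans (∑-cong xs f≈ε) (∑-ε xs)

  ∑-∙ : ∀ (xs : List A) f g → ∑ xs (λ x → f x ∙ g x) ≈ ∑ xs f ∙ ∑ xs g
  ∑-∙ []       f g = ≈-sym (identityˡ ε)
  ∑-∙ (x ∷ xs) f g = ≈-trans (∙-congˡ (∑-∙ xs f g)) (interchange _ _ _ _)

  ∑-· : ∀ n (xs : List A) f → ∑ xs (λ x → n · f x) ≈ n · ∑ xs f
  ∑-· zero    xs f = ∑-ε xs
  ∑-· (suc n) xs f = ≈-trans (∑-∙ xs f (λ x → n · f x)) (∙-congˡ (∑-· n xs f))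

  ∑-·ʳ : ∀ (xs : List A) g y → ∑ xs (λ x → g x · y) ≈ sum (map g xs) · y
  ∑-·ʳ []       g y = ≈-refl
  ∑-·ʳ (x ∷ xs) g y = ≈-trans (∙-congˡ (∑-·ʳ xs g y)) (≈-sym (×-homo-+ y (g x) _))

  ∑-swap : ∀ (xs : List A) (ys : List B) (f : A → B → Carrier) →
           ∑ xs (λ x → ∑ ys (f x)) ≈ ∑ ys (λ y → ∑ xs (λ x → f x y))
  ∑-swap []       ys f = ≈-sym (∑-ε ys)
  ∑-swap (x ∷ xs) ys f = ≈-trans (∙-congˡ (∑-swap xs ys f)) (≈-sym (∑-∙ ys (f x) _))

  ∑-↭ : ∀ {xs ys : List A} f → xs ↭ ys → ∑ xs f ≈ ∑ ys f
  ∑-↭ f Perm.refl         = ≈-refl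
  ∑-↭ f (Perm.prep x p)   = ∙-congˡ (∑-↭ f p)
  ∑-↭ f (Perm.swap x y p) = ≈-trans (x∙yz≈y∙xz _ _ _) (∙-congˡ (∙-congˡ (∑-↭ f p)))
  ∑-↭ f (Perm.trans p q)  = ≈-trans (∑-↭ f p) (∑-↭ f q)

  ∑-map : ∀ (xs : List A) (g : A → B) f → ∑ (map g xs) f ≈ ∑ xs (f ∘ g)
  ∑-map []       g f = ≈-refl
  ∑-map (x ∷ xs) g f = ∙-congˡ (∑-map xs g f)

  ∑-++ : ∀ (xs ys : List A) f → ∑ (xs ++ ys) f ≈ ∑ xs f ∙ ∑ ys f
  ∑-++ []       ys f = ≈-sym (identityˡ _)
  ∑-++ (x ∷ xs) ys f = ≈-trans (∙-congˡ (∑-++ xs ys f)) (≈-sym (assoc _ _ _))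

  ∑-filter : ∀ {p} {P : A → Set p} (P? : Decidable P) (xs : List A) f →
             ∑ (filter P? xs) f ≈ ∑ xs (λ x → if does (P? x) then f x else ε)
  ∑-filter P? []       f = ≈-refl
  ∑-filter P? (x ∷ xs) f with does (P? x)
  ... | true  = ∙-congˡ (∑-filter P? xs f)
  ... | false = ≈-trans (∑-filter P? xs f) (≈-sym (identityˡ _))

  ∑-filter-support : ∀ {p} {P : A → Set p} (P? : Decidable P) (xs : List A) {f} →
                     (∀ {x} → ¬ P x → f x ≈ ε) → ∑ (filter P? xs) f ≈ ∑ xs f
  ∑-filter-support P? xs {f} supp = ≈-trans (∑-filter P? xs f) (∑-cong xs (λ {x} _ → drop x))
    where
    drop : ∀ x → (if does (P? x) then f x else ε) ≈ f x
    drop x with P? x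
    ... | yes _  = ≈-refl
    ... | no ¬Px = ≈-sym (supp ¬Px)

  ∑-suc : ∀ n f → ∑ [1⋯ suc n ] f ≈ ∑ [1⋯ n ] f ∙ f (suc n)
  ∑-suc n f = begin
    ∑ [1⋯ suc n ] f           ≡⟨ cong (λ xs → ∑ xs f) (applyUpTo-∷ʳ suc n) ⟨
    ∑ ([1⋯ n ] ∷ʳ suc n) f    ≈⟨ ∑-++ [1⋯ n ] [ suc n ] f ⟩
    ∑ [1⋯ n ] f ∙ (f (suc n) ∙ ε) ≈⟨ ∙-congˡ (identityʳ _) ⟩
    ∑ [1⋯ n ] f ∙ f (suc n)   ∎

  ∑-suc-upTo : ∀ n f → ∑ (upTo (suc n)) f ≈ ∑ (upTo n) f ∙ f n
  ∑-suc-upTo n f = begin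
    ∑ (upTo (suc n)) f      ≡⟨ cong (λ xs → ∑ xs f) (applyUpTo-∷ʳ (λ x → x) n) ⟨
    ∑ (upTo n ∷ʳ n) f       ≈⟨ ∑-++ (upTo n) [ n ] f ⟩
    ∑ (upTo n) f ∙ (f n ∙ ε) ≈⟨ ∙-congˡ (identityʳ _) ⟩
    ∑ (upTo n) f ∙ f n      ∎

  ∑-reverse : ∀ n f → ∑ (upTo n) (λ s → f (n ∸ s)) ≈ ∑ [1⋯ n ] f
  ∑-reverse zero    f = ≈-refl
  ∑-reverse (suc n) f = begin
    f (suc n) ∙ ∑ (applyUpTo suc n) (λ s → f (suc n ∸ s))
      -- After the index shift `suc n ∸ suc s` computes to `n ∸ s`, so the induction hypothesis
      -- applies; the detached term s = 0 is the last term on the other side.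
      ≡⟨ cong (λ xs → f (suc n) ∙ ∑ xs (λ s → f (suc n ∸ s))) (map-upTo suc n) ⟨
    f (suc n) ∙ ∑ (map suc (upTo n)) (λ s → f (suc n ∸ s))
      ≈⟨ ∙-congˡ (∑-map (upTo n) suc _) ⟩
    f (suc n) ∙ ∑ (upTo n) (λ s → f (n ∸ s)) ≈⟨ ∙-congˡ (∑-reverse n f) ⟩
    f (suc n) ∙ ∑ [1⋯ n ] f                  ≈⟨ comm _ _ ⟩
    ∑ [1⋯ n ] f ∙ f (suc n)                  ≈⟨ ∑-suc n f ⟨
    ∑ [1⋯ suc n ] f                          ∎

  ∑-split : ∀ m n f → ∑ [1⋯ m + n ] f ≈ ∑ [1⋯ m ] f ∙ ∑ [1⋯ n ] (f ∘ (m +_))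
  ∑-split m zero    f rewrite +-identityʳ m = ≈-sym (identityʳ _)
  ∑-split m (suc n) f rewrite +-suc m n = begin
    ∑ [1⋯ suc (m + n) ] f ≈⟨ ∑-suc (m + n) f ⟩
    ∑ [1⋯ m + n ] f ∙ f (suc (m + n)) ≈⟨ ∙-congʳ (∑-split m n f) ⟩
    (∑ [1⋯ m ] f ∙ ∑ [1⋯ n ] (f ∘ (m +_))) ∙ f (suc (m + n)) ≈⟨ assoc _ _ _ ⟩
    ∑ [1⋯ m ] f ∙ (∑ [1⋯ n ] (f ∘ (m +_)) ∙ f (suc (m + n)))
      ≡⟨ cong (λ k → ∑ [1⋯ m ] f ∙ (∑ [1⋯ n ] (f ∘ (m +_)) ∙ f k)) (+-suc m n) ⟨
    ∑ [1⋯ m ] f ∙ (∑ [1⋯ n ] (f ∘ (m +_)) ∙ f (m + suc n)) ≈⟨ ∙-congˡ (∑-suc n (f ∘ (m +_))) ⟨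
    ∑ [1⋯ m ] f ∙ ∑ [1⋯ suc n ] (f ∘ (m +_)) ∎

  ∑-truncate : ∀ {m n f} → m ≤ n → (∀ {k} → m < k → f k ≈ ε) → ∑ [1⋯ n ] f ≈ ∑ [1⋯ m ] f
  ∑-truncate {zero}  {n} _ f≈ε = ∑-zero [1⋯ n ] λ k∈ → let 1≤k , _ = ∈-[1⋯]⁻ k∈ in f≈ε 1≤k
  ∑-truncate {suc m} {n} {f} m<n f≈ε with m≤n⇒∃[o]m+o≡n m<n
  ... | o , refl = begin
    ∑ [1⋯ suc m + o ] f ≈⟨ ∑-split (suc m) o f ⟩
    ∑ [1⋯ suc m ] f ∙ ∑ [1⋯ o ] (f ∘ (suc m +_))
      ≈⟨ ∙-congˡ (∑-zero [1⋯ o ] λ k∈ → let 1≤k , _ = ∈-[1⋯]⁻ k∈ in f≈ε (m<m+n (suc m) 1≤k)) ⟩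
    ∑ [1⋯ suc m ] f ∙ ε ≈⟨ identityʳ _ ⟩
    ∑ [1⋯ suc m ] f ∎

  -- Inserting a part k affects only the term at index k. This carries that change over to the
  -- total, additively in `∑-mult` and multiplicatively in `z-insert`.
  ∑-update : ∀ {n k f g x} → 1 ≤ k → k ≤ n → (∀ {j} → j ≢ k → f j ≈ g j) → f k ≈ x ∙ g k →
             ∑ [1⋯ n ] f ≈ x ∙ ∑ [1⋯ n ] g
  ∑-update {zero} (s≤s _) ()
  ∑-update {suc n} {k} {f} {g} {x} 1≤k k≤ f≈g fk with k ≟ suc n
  ... | yes refl = begin
    ∑ [1⋯ suc n ] f ≈⟨ ∑-suc n f ⟩
    ∑ [1⋯ n ] f ∙ f (suc n)
      ≈⟨ ∙-cong (∑-cong [1⋯ n ] λ j∈ → let _ , j≤n = ∈-[1⋯]⁻ j∈ in f≈g (<⇒≢ (s≤s j≤n))) fk ⟩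
    ∑ [1⋯ n ] g ∙ (x ∙ g (suc n)) ≈⟨ x∙yz≈y∙xz _ _ _ ⟩
    x ∙ (∑ [1⋯ n ] g ∙ g (suc n)) ≈⟨ ∙-congˡ (∑-suc n g) ⟨
    x ∙ ∑ [1⋯ suc n ] g ∎
  ... | no k≢ = begin
    ∑ [1⋯ suc n ] f ≈⟨ ∑-suc n f ⟩
    ∑ [1⋯ n ] f ∙ f (suc n)
      ≈⟨ ∙-cong (∑-update 1≤k (≤-pred (≤∧≢⇒< k≤ k≢)) f≈g fk) (f≈g (k≢ ∘ sym)) ⟩
    (x ∙ ∑ [1⋯ n ] g) ∙ g (suc n) ≈⟨ assoc _ _ _ ⟩
    x ∙ (∑ [1⋯ n ] g ∙ g (suc n)) ≈⟨ ∙-congˡ (∑-suc n g) ⟨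
    x ∙ ∑ [1⋯ suc n ] g ∎

module ∑ℕ = ListSum +-0-commutativeMonoid
module ∏  = ListSum *-1-commutativeMonoid
module ∑ℚ = ListSum ℚ.+-0-commutativeMonoid

-- Inserting a part

-- A multiset has only one sorted arrangement. Hence partitions can be compared as multisets, and
-- the positions of parts never matter.
nonIncreasing-↭⇒≡ : ∀ {μ ν} → Linked _≥_ μ → Linked _≥_ ν → μ ↭ ν → μ ≡ ν
nonIncreasing-↭⇒≡ μ↘ ν↘ μ↭ν =
  Pointwise-≡⇒≡ (↗↭↗⇒≋ (DecTotalOrder.totalOrder ≥-decTotalOrder) μ↘ ν↘ (↭⇒↭ₛ μ↭ν))

open IsPartition

∈-partitions⁻ : ∀ n {μ} → μ ∈ partitions n → IsPartition n μ
∈-partitions⁻ _ = Equivalence.to (∈-partitions _ _)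

∈-partitions⁺ : ∀ {n μ} → IsPartition n μ → μ ∈ partitions n
∈-partitions⁺ = Equivalence.from (∈-partitions _ _)

insert-isPartition : ∀ {k r μ} → 1 ≤ k → IsPartition r μ → IsPartition (k + r) (insert k μ)
insert-isPartition {k} {μ = μ} 1≤k μ⊢r .positive =
  All-resp-↭ (↭-sym (insert-↭ k μ)) (1≤k ∷ μ⊢r .positive)
insert-isPartition {k} 1≤k μ⊢r .nonIncreasing = insert-↗ k (μ⊢r .nonIncreasing)
insert-isPartition {k} {μ = μ} 1≤k μ⊢r .total =
  trans (sum-↭ (insert-↭ k μ)) (cong (k +_) (μ⊢r .total))

-- Delete one occurrence of k and sort what is left. Sorting makes ν non-increasing without an
-- argument about deletion, and `μ` and `insert k ν` are then non-increasing lists with the same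
-- parts.
remove-part : ∀ {k r μ} → IsPartition (k + r) μ → k ∈ μ →
  ∃ λ ν → IsPartition r ν × μ ≡ insert k ν
remove-part {k} {r} {μ} μ⊢ k∈μ with ∈-∃++ k∈μ
... | ys , zs , refl =
  ν ,
  isPartition (All.tail (All-resp-↭ μ↭k∷ν (μ⊢ .positive))) (sort-↗ (ys ++ zs)) ν-total ,
  nonIncreasing-↭⇒≡ (μ⊢ .nonIncreasing) (insert-↗ k (sort-↗ (ys ++ zs)))
    (↭-trans μ↭k∷ν (↭-sym (insert-↭ k ν)))
  where
  ν = sort (ys ++ zs)
  μ↭k∷ν : ys ++ [ k ] ++ zs ↭ k ∷ ν
  μ↭k∷ν = ↭-trans (shift k ys zs) (Perm.prep k (↭-sym (sort-↭ (ys ++ zs))))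
  ν-total : sum ν ≡ r
  ν-total = +-cancelˡ-≡ k _ _ (trans (sym (sum-↭ μ↭k∷ν)) (μ⊢ .total))

insert-injective : ∀ {k r μ ν} → IsPartition r μ → IsPartition r ν → insert k μ ≡ insert k ν → μ ≡ ν
insert-injective {k} {μ = μ} {ν} μ⊢ ν⊢ eq = nonIncreasing-↭⇒≡ (μ⊢ .nonIncreasing) (ν⊢ .nonIncreasing)
  (drop-∷ (↭-trans (↭-sym (insert-↭ k μ)) (↭-trans (↭-reflexive eq) (insert-↭ k ν))))

-- Injectivity is asked only on members of `xs`, since `insert-injective` speaks only of partitions.
unique-map : ∀ {A B : Set} {f : A → B} {xs} →
  (∀ {x y} → x ∈ xs → y ∈ xs → f x ≡ f y → x ≡ y) → Unique xs → Unique (map f xs)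
unique-map inj [] = []
unique-map {f = f} {x ∷ xs} inj (x∉ ∷ u) =
  All.tabulate fresh ∷ unique-map (λ p q → inj (there p) (there q)) u
  where
  fresh : ∀ {y} → y ∈ map f xs → f x ≢ y
  fresh y∈ eq with ∈-map⁻ f y∈
  ... | z , z∈ , refl = All.lookup x∉ z∈ (inj (here refl) (there z∈) eq)

-- Both lists are free of repetitions and have the same members, by `remove-part` in one direction
-- and `insert-isPartition` in the other; such lists are permutations of each other.
partitions-with-part : ∀ {k} r → 1 ≤ k →
  filter (∈? _≟_ k) (partitions (k + r)) ↭ map (insert k) (partitions r)
partitions-with-part {k} r 1≤k = ∼bag⇒↭ (unique∧set⇒bag
  (Unique.filter⁺ (∈? _≟_ k) (partitions-unique (k + r)))
  (unique-map (λ p q → insert-injective (∈-partitions⁻ r p) (∈-partitions⁻ r q)) (partitions-unique r))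
  (mk⇔ to from))
  where
  to : ∀ {μ} → μ ∈ filter (∈? _≟_ k) (partitions (k + r)) → μ ∈ map (insert k) (partitions r)
  to μ∈ with ∈-filter⁻ (∈? _≟_ k) {xs = partitions (k + r)} μ∈
  ... | μ∈P , k∈μ with remove-part {r = r} (∈-partitions⁻ (k + r) μ∈P) k∈μ
  ...   | ν , ν⊢r , refl = ∈-map⁺ (insert k) (∈-partitions⁺ ν⊢r)
  from : ∀ {μ} → μ ∈ map (insert k) (partitions r) → μ ∈ filter (∈? _≟_ k) (partitions (k + r))
  from μ∈ with ∈-map⁻ (insert k) μ∈
  ... | ν , ν∈ , refl = ∈-filter⁺ (∈? _≟_ k)
    (∈-partitions⁺ (insert-isPartition 1≤k (∈-partitions⁻ r ν∈)))
    (∈-resp-↭ (↭-sym (insert-↭ k ν)) (here refl))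

-- Multiplicities, z and σ under insertion of a part

mult-↭ : ∀ k {μ ν} → μ ↭ ν → mult k μ ≡ mult k ν
mult-↭ k μ↭ν = ↭-length (filter-↭ (k ≟_) μ↭ν)

mult-∷-≡ : ∀ k μ → mult k (k ∷ μ) ≡ suc (mult k μ)
mult-∷-≡ k μ = cong length (filter-accept (k ≟_) {xs = μ} refl)

mult-∷-≢ : ∀ {k x} μ → k ≢ x → mult k (x ∷ μ) ≡ mult k μ
mult-∷-≢ {k} μ k≢x = cong length (filter-reject (k ≟_) {xs = μ} k≢x)

mult-∉ : ∀ {k} μ → k ∉ μ → mult k μ ≡ 0
mult-∉ {k} μ k∉μ = cong length (filter-none (k ≟_) (All.tabulate λ x∈ → λ { refl → k∉μ x∈ }))

mult-insert : ∀ k μ → mult k (insert k μ) ≡ suc (mult k μ)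
mult-insert k μ = trans (mult-↭ k (insert-↭ k μ)) (mult-∷-≡ k μ)

∈⇒≤sum : ∀ {k μ} → k ∈ μ → k ≤ sum μ
∈⇒≤sum {k} {_ ∷ μ} (here refl) = m≤m+n k (sum μ)
∈⇒≤sum {μ = x ∷ _} (there k∈μ) = m≤n⇒m≤o+n x (∈⇒≤sum k∈μ)

-- Each part x raises the term at k = x by x. The range is any n ≥ `sum μ`, so that it stays fixed
-- when the induction passes to the tail.
∑-mult : ∀ {n μ} → All (1 ≤_) μ → sum μ ≤ n → ∑ℕ.∑ [1⋯ n ] (λ k → k * mult k μ) ≡ sum μ
∑-mult {n} [] _ = ∑ℕ.∑-zero [1⋯ n ] λ {k} _ → *-zeroʳ k
∑-mult {n} {x ∷ μ} (1≤x ∷ μ>0) x+μ≤n = begin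
  ∑ℕ.∑ [1⋯ n ] (λ k → k * mult k (x ∷ μ))
    ≡⟨ ∑ℕ.∑-update 1≤x (m+n≤o⇒m≤o x x+μ≤n) (λ {k} k≢x → cong (k *_) (mult-∷-≢ μ k≢x))
         (trans (cong (x *_) (mult-∷-≡ x μ)) (*-suc x _)) ⟩
  x + ∑ℕ.∑ [1⋯ n ] (λ k → k * mult k μ) ≡⟨ cong (x +_) (∑-mult μ>0 (m+n≤o⇒n≤o x x+μ≤n)) ⟩
  x + sum μ ∎
  where open ≡-Reasoning

z-factor : List ℕ → ℕ → ℕ
z-factor μ k = k ^ mult k μ * mult k μ !

z-truncate : ∀ {n} μ → sum μ ≤ n → ∏.∑ [1⋯ n ] (z-factor μ) ≡ z μ
z-truncate μ sumμ≤n = ∏.∑-truncate sumμ≤n λ {k} sumμ<k →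
  cong (λ m → k ^ m * m !) (mult-∉ μ (<⇒≱ sumμ<k ∘ ∈⇒≤sum))

-- Only the factor at k changes: with m = `mult k μ`, it goes from k^m m! to k^(m+1) (m+1)!. The
-- range now ends at `k + sum μ`, and `z-truncate` cuts it back for `μ`.
z-insert : ∀ {k} μ → 1 ≤ k → z (insert k μ) ≡ k * suc (mult k μ) * z μ
z-insert {k} μ 1≤k = begin
  z (insert k μ) ≡⟨ cong (λ n → ∏.∑ [1⋯ n ] (z-factor (insert k μ))) (sum-↭ (insert-↭ k μ)) ⟩
  ∏.∑ [1⋯ k + sum μ ] (z-factor (insert k μ))
    ≡⟨ ∏.∑-update {x = k * suc (mult k μ)} 1≤k (m≤m+n k (sum μ))
         (λ {j} j≢k → cong (λ m → j ^ m * m !) (trans (mult-↭ j (insert-↭ k μ)) (mult-∷-≢ μ j≢k)))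
         (trans (cong (λ m → k ^ m * m !) (mult-insert k μ))
                (regroup k (k ^ mult k μ) (suc (mult k μ)) (mult k μ !))) ⟩
  k * suc (mult k μ) * ∏.∑ [1⋯ k + sum μ ] (z-factor μ)
    ≡⟨ cong (k * suc (mult k μ) *_) (z-truncate μ (m≤n+m (sum μ) k)) ⟩
  k * suc (mult k μ) * z μ ∎
  where
  open ≡-Reasoning
  regroup : ∀ a b c d → a * b * (c * d) ≡ a * c * (b * d)
  regroup = solve-∀

σ-parts-insert : ∀ k μ → σ-parts (insert k μ) ≡ σ k * σ-parts μ
σ-parts-insert k μ = product-↭ (map⁺ σ (insert-↭ k μ))

-- Sums over partitions, weighted by multiplicity

module PartitionSum {c ℓ} (M : CommutativeMonoid c ℓ) where
  open CommutativeMonoid M using (Carrier; _≈_; ε; setoid)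
    renaming (sym to ≈-sym; trans to ≈-trans)
  open import Algebra.Properties.CommutativeMonoid.Mult M using (×-assocˡ; ×-congˡ) renaming (_×_ to _·_)
  open ListSum M
  open import Relation.Binary.Reasoning.Setoid setoid

  ∑-insert : ∀ {k} r (f : List ℕ → Carrier) → 1 ≤ k → (∀ {μ} → k ∉ μ → f μ ≈ ε) →
    ∑ (partitions (k + r)) f ≈ ∑ (partitions r) (f ∘ insert k)
  ∑-insert {k} r f 1≤k f≈ε = begin
    ∑ (partitions (k + r)) f ≈⟨ ∑-filter-support (∈? _≟_ k) (partitions (k + r)) f≈ε ⟨
    ∑ (filter (∈? _≟_ k) (partitions (k + r))) f ≈⟨ ∑-↭ f (partitions-with-part r 1≤k) ⟩
    ∑ (map (insert k) (partitions r)) f ≈⟨ ∑-map (partitions r) (insert k) f ⟩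
    ∑ (partitions r) (f ∘ insert k) ∎

  -- The factor `mult k μ` kills every partition without the part k, so the sum runs over insertions
  -- of k.
  ∑-mult-insert : ∀ {k} r (f : List ℕ → Carrier) → 1 ≤ k →
    ∑ (partitions (k + r)) (λ μ → mult k μ · f μ) ≈
    ∑ (partitions r) (λ μ → suc (mult k μ) · f (insert k μ))
  ∑-mult-insert {k} r f 1≤k = ≈-trans
    (∑-insert r (λ μ → mult k μ · f μ) 1≤k (λ {μ} k∉μ → ×-congˡ {f μ} (mult-∉ μ k∉μ)))
    (∑-cong (partitions r) λ {μ} _ → ×-congˡ {f (insert k μ)} (mult-insert k μ))

  -- For each partition of n, write n as the sum of k times the multiplicity of k, then exchange the
  -- two sums.
  ·-∑-partitions : ∀ n (f : List ℕ → Carrier) → n · ∑ (partitions n) f ≈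
    ∑ [1⋯ n ] λ k → k · ∑ (partitions n) λ μ → mult k μ · f μ
  ·-∑-partitions n f = begin
    n · ∑ (partitions n) f ≈⟨ ∑-· n (partitions n) f ⟨
    ∑ (partitions n) (λ μ → n · f μ) ≈⟨ ∑-cong (partitions n) expand ⟩
    ∑ (partitions n) (λ μ → ∑ [1⋯ n ] λ k → k · (mult k μ · f μ)) ≈⟨ ∑-swap (partitions n) [1⋯ n ] _ ⟩
    ∑ [1⋯ n ] (λ k → ∑ (partitions n) λ μ → k · (mult k μ · f μ))
      ≈⟨ ∑-cong [1⋯ n ] (λ {k} _ → ∑-· k (partitions n) _) ⟩
    ∑ [1⋯ n ] (λ k → k · ∑ (partitions n) λ μ → mult k μ · f μ) ∎
    where
    expand : ∀ {μ} → μ ∈ partitions n → n · f μ ≈ ∑ [1⋯ n ] (λ k → k · (mult k μ · f μ))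
    expand {μ} μ∈ = begin
      n · f μ ≈⟨ ×-congˡ {f μ} (trans (∑-mult {n} (μ⊢n .positive) (≤-reflexive (μ⊢n .total))) (μ⊢n .total)) ⟨
      ∑ℕ.∑ [1⋯ n ] (λ k → k * mult k μ) · f μ ≈⟨ ∑-·ʳ [1⋯ n ] (λ k → k * mult k μ) (f μ) ⟨
      ∑ [1⋯ n ] (λ k → (k * mult k μ) · f μ) ≈⟨ ∑-cong [1⋯ n ] (λ {k} _ → ×-assocˡ (f μ) k (mult k μ)) ⟨
      ∑ [1⋯ n ] (λ k → k · (mult k μ · f μ)) ∎
      where μ⊢n = ∈-partitions⁻ n μ∈

module Pℕ = PartitionSum +-0-commutativeMonoid
module Pℚ = PartitionSum ℚ.+-0-commutativeMonoid

open ≡-Reasoning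
open ∑ℕ using (∑)

-- The recurrence for p

·ℕ≡* : ∀ n x → n ·ℕ x ≡ n * x
·ℕ≡* zero    x = refl
·ℕ≡* (suc n) x = cong (x +_) (·ℕ≡* n x)

∑-1 : ∀ {A : Set} (xs : List A) → ∑ xs (λ _ → 1) ≡ length xs
∑-1 []       = refl
∑-1 (x ∷ xs) = cong suc (∑-1 xs)

∑-*ˡ : ∀ {A : Set} n (xs : List A) (f : A → ℕ) → ∑ xs (λ x → n * f x) ≡ n * ∑ xs f
∑-*ˡ n xs f = trans (∑ℕ.∑-cong xs λ {x} _ → sym (·ℕ≡* n (f x))) (trans (∑ℕ.∑-· n xs f) (·ℕ≡* n (∑ xs f)))

∑-*ʳ : ∀ {A : Set} n (xs : List A) (f : A → ℕ) → ∑ xs (λ x → f x * n) ≡ ∑ xs f * n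
∑-*ʳ n xs f = trans (∑ℕ.∑-cong xs λ {x} _ → sym (·ℕ≡* (f x) n)) (trans (∑ℕ.∑-·ʳ xs f n) (·ℕ≡* (∑ xs f) n))

totalMult : ℕ → ℕ → ℕ
totalMult k n = ∑ (partitions n) (mult k)

mult·1 : ∀ n k → ∑ (partitions n) (λ μ → mult k μ ·ℕ 1) ≡ totalMult k n
mult·1 n k = ∑ℕ.∑-cong (partitions n) λ {μ} _ → trans (·ℕ≡* (mult k μ) 1) (*-identityʳ _)

-- The inserted copy of k counts once for each partition of r, which gives `p r`; the copies already
-- present give the rest.
totalMult-+ : ∀ {k} r → 1 ≤ k → totalMult k (k + r) ≡ p r + totalMult k r
totalMult-+ {k} r 1≤k = begin
  totalMult k (k + r) ≡⟨ mult·1 (k + r) k ⟨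
  ∑ (partitions (k + r)) (λ μ → mult k μ ·ℕ 1) ≡⟨ Pℕ.∑-mult-insert r (λ _ → 1) 1≤k ⟩
  ∑ (partitions r) (λ μ → suc (mult k μ) ·ℕ 1) ≡⟨ ∑ℕ.∑-∙ (partitions r) (λ _ → 1) (λ μ → mult k μ ·ℕ 1) ⟩
  ∑ (partitions r) (λ _ → 1) + ∑ (partitions r) (λ μ → mult k μ ·ℕ 1)
    ≡⟨ cong₂ _+_ (∑-1 (partitions r)) (mult·1 r k) ⟩
  p r + totalMult k r ∎

totalMult-< : ∀ {k n} → n < k → totalMult k n ≡ 0
totalMult-< {k} {n} n<k = ∑ℕ.∑-zero (partitions n) λ {μ} μ∈ → mult-∉ μ λ k∈μ →
  <⇒≱ n<k (subst (k ≤_) (IsPartition.total (∈-partitions⁻ n μ∈)) (∈⇒≤sum k∈μ))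

infixr 8 ⟦_∣_⟧_
-- An Iverson bracket, in the form that `∑-filter` produces from the filter in `σ`.
⟦_∣_⟧_ : ℕ → ℕ → ℕ → ℕ
⟦ k ∣ d ⟧ x = if does (k ∣? d) then x else 0

⟦∤⟧ : ∀ {k d x} → 1 ≤ d → d < k → ⟦ k ∣ d ⟧ x ≡ 0
⟦∤⟧ {k} {d} {x} 1≤d d<k = cong (if_then x else 0)
  (dec-false (k ∣? d) λ k∣d → <⇒≱ d<k (∣⇒≤ {{>-nonZero 1≤d}} k∣d))

⟦∣⟧-+ : ∀ k d x → ⟦ k ∣ k + d ⟧ x ≡ ⟦ k ∣ d ⟧ x
⟦∣⟧-+ k d x = cong (if_then x else 0)
  (does-⇔ (mk⇔ (λ k∣k+d → ∣m+n∣m⇒∣n k∣k+d ∣-refl) (∣m∣n⇒∣m+n ∣-refl)) (k ∣? k + d) (k ∣? d))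

⟦∣⟧-* : ∀ k d x y → x * ⟦ k ∣ d ⟧ y ≡ ⟦ k ∣ d ⟧ x * y
⟦∣⟧-* k d x y with does (k ∣? d)
... | true  = refl
... | false = *-zeroʳ x

-- Up to k the only multiple of k is k itself, contributing `p r`; beyond k, the shift d ↦ k + d
-- preserves divisibility by k. The recursion agrees with `totalMult-+`.
multiples-sum-+ : ∀ {k} r → 1 ≤ k → ∑ [1⋯ k + r ] (λ d → ⟦ k ∣ d ⟧ p (k + r ∸ d)) ≡
  p r + ∑ [1⋯ r ] (λ d → ⟦ k ∣ d ⟧ p (r ∸ d))
multiples-sum-+ {k} r 1≤k = begin
  ∑ [1⋯ k + r ] f ≡⟨ ∑ℕ.∑-split k r f ⟩
  ∑ [1⋯ k ] f + ∑ [1⋯ r ] (f ∘ (k +_)) ≡⟨ cong₂ _+_ (first 1≤k) (∑ℕ.∑-cong [1⋯ r ] λ {d} _ →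
      trans (⟦∣⟧-+ k d _) (cong (⟦ k ∣ d ⟧_ ∘ p) ([m+n]∸[m+o]≡n∸o k r d))) ⟩
  p r + ∑ [1⋯ r ] (λ d → ⟦ k ∣ d ⟧ p (r ∸ d)) ∎
  where
  f : ℕ → ℕ
  f d = ⟦ k ∣ d ⟧ p (k + r ∸ d)
  fk : f k ≡ p r
  fk = trans (cong (if_then p (k + r ∸ k) else 0) (dec-true (k ∣? k) ∣-refl)) (cong p (m+n∸m≡n k r))
  first : 1 ≤ k → ∑ [1⋯ k ] f ≡ p r
  first (s≤s {n = j} _) = trans (∑ℕ.∑-suc j f) (cong₂ _+_
    (∑ℕ.∑-zero [1⋯ j ] λ d∈ → let 1≤d , d≤j = ∈-[1⋯]⁻ d∈ in ⟦∤⟧ 1≤d (s≤s d≤j)) fk)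

-- Both sides vanish for n < k and obey the same recursion from n - k to n, so strong induction
-- identifies them.
totalMult≡ : ∀ {k} → 1 ≤ k → ∀ n → totalMult k n ≡ ∑ [1⋯ n ] (λ d → ⟦ k ∣ d ⟧ p (n ∸ d))
totalMult≡ {k} 1≤k = <-rec _ go
  where
  go : ∀ n → (∀ {m} → m < n → totalMult k m ≡ ∑ [1⋯ m ] (λ d → ⟦ k ∣ d ⟧ p (m ∸ d))) →
       totalMult k n ≡ ∑ [1⋯ n ] (λ d → ⟦ k ∣ d ⟧ p (n ∸ d))
  go n rec with k ≤? n
  ... | no k≰n = trans (totalMult-< (≰⇒> k≰n)) (sym (∑ℕ.∑-zero [1⋯ n ] λ d∈ →
    let 1≤d , d≤n = ∈-[1⋯]⁻ d∈ in ⟦∤⟧ 1≤d (≤-<-trans d≤n (≰⇒> k≰n))))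
  ... | yes k≤n with m≤n⇒∃[o]m+o≡n k≤n
  ...   | r , refl = begin
    totalMult k (k + r) ≡⟨ totalMult-+ r 1≤k ⟩
    p r + totalMult k r ≡⟨ cong (p r +_) (rec (m<n+m r 1≤k)) ⟩
    p r + ∑ [1⋯ r ] (λ d → ⟦ k ∣ d ⟧ p (r ∸ d)) ≡⟨ multiples-sum-+ r 1≤k ⟨
    ∑ [1⋯ k + r ] (λ d → ⟦ k ∣ d ⟧ p (k + r ∸ d)) ∎

∑-⟦∣⟧ : ∀ {n d} → 1 ≤ d → d ≤ n → ∑ [1⋯ n ] (λ k → ⟦ k ∣ d ⟧ k) ≡ σ d
∑-⟦∣⟧ {n} {d} 1≤d d≤n = begin
  ∑ [1⋯ n ] (λ k → ⟦ k ∣ d ⟧ k) ≡⟨ ∑ℕ.∑-truncate d≤n (⟦∤⟧ 1≤d) ⟩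
  ∑ [1⋯ d ] (λ k → ⟦ k ∣ d ⟧ k) ≡⟨ ∑ℕ.∑-filter (_∣? d) [1⋯ d ] (λ k → k) ⟨
  ∑ (filter (_∣? d) [1⋯ d ]) (λ k → k) ≡⟨ cong sum (map-id (filter (_∣? d) [1⋯ d ])) ⟩
  σ d ∎

n*p≡∑σ*p : ∀ n → n * p n ≡ ∑ [1⋯ n ] (λ d → σ d * p (n ∸ d))
n*p≡∑σ*p n = begin
  n * p n ≡⟨ ·ℕ≡* n (p n) ⟨
  n ·ℕ p n ≡⟨ cong (n ·ℕ_) (∑-1 (partitions n)) ⟨
  n ·ℕ ∑ (partitions n) (λ _ → 1) ≡⟨ Pℕ.·-∑-partitions n (λ _ → 1) ⟩
  ∑ [1⋯ n ] (λ k → k ·ℕ ∑ (partitions n) (λ μ → mult k μ ·ℕ 1))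
    ≡⟨ ∑ℕ.∑-cong [1⋯ n ] (λ {k} k∈ → let 1≤k , _ = ∈-[1⋯]⁻ k∈ in begin
         k ·ℕ ∑ (partitions n) (λ μ → mult k μ ·ℕ 1) ≡⟨ ·ℕ≡* k _ ⟩
         k * ∑ (partitions n) (λ μ → mult k μ ·ℕ 1)
           ≡⟨ cong (k *_) (trans (mult·1 n k) (totalMult≡ 1≤k n)) ⟩
         k * ∑ [1⋯ n ] (λ d → ⟦ k ∣ d ⟧ p (n ∸ d)) ≡⟨ ∑-*ˡ k [1⋯ n ] _ ⟨
         ∑ [1⋯ n ] (λ d → k * ⟦ k ∣ d ⟧ p (n ∸ d))
           ≡⟨ ∑ℕ.∑-cong [1⋯ n ] (λ {d} _ → ⟦∣⟧-* k d k (p (n ∸ d))) ⟩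
         ∑ [1⋯ n ] (λ d → ⟦ k ∣ d ⟧ k * p (n ∸ d)) ∎) ⟩
  ∑ [1⋯ n ] (λ k → ∑ [1⋯ n ] (λ d → ⟦ k ∣ d ⟧ k * p (n ∸ d)))
    -- With d outermost, the inner sum collects the divisors k of d and becomes `σ d`.
    ≡⟨ ∑ℕ.∑-swap [1⋯ n ] [1⋯ n ] (λ k d → ⟦ k ∣ d ⟧ k * p (n ∸ d)) ⟩
  ∑ [1⋯ n ] (λ d → ∑ [1⋯ n ] (λ k → ⟦ k ∣ d ⟧ k * p (n ∸ d)))
    ≡⟨ ∑ℕ.∑-cong [1⋯ n ] (λ {d} d∈ → let 1≤d , d≤n = ∈-[1⋯]⁻ d∈ in
         trans (∑-*ʳ (p (n ∸ d)) [1⋯ n ] (λ k → ⟦ k ∣ d ⟧ k)) (cong (_* p (n ∸ d)) (∑-⟦∣⟧ 1≤d d≤n))) ⟩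
  ∑ [1⋯ n ] (λ d → σ d * p (n ∸ d)) ∎

-- The recurrence for the weighted sum

/-cross : ∀ a b c d .{{_ : NonZero b}} .{{_ : NonZero d}} → a * d ≡ c * b → ℤ.+ a ℚ./ b ≡ ℤ.+ c ℚ./ d
/-cross a (suc b) c (suc d) eq = ℚ.fromℚᵘ-cong {mkℚᵘ (ℤ.+ a) b} {mkℚᵘ (ℤ.+ c) d}
  (*≡* (trans (sym (ℤ.pos-* a (suc d))) (trans (cong ℤ.+_ eq) (ℤ.pos-* c (suc b)))))

-- Checked on unnormalised fractions, where no reduction to lowest terms intervenes and the claim is
-- a polynomial identity.
+-/ : ∀ a c b .{{_ : NonZero b}} → ℤ.+ a ℚ./ b ℚ.+ ℤ.+ c ℚ./ b ≡ ℤ.+ (a + c) ℚ./ b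
+-/ a c (suc b) = ℚ.toℚᵘ-injective (ℚᵘ.≃-trans (ℚ.toℚᵘ-homo-+ (ℤ.+ a ℚ./ suc b) (ℤ.+ c ℚ./ suc b))
  (ℚᵘ.≃-trans (ℚᵘ.+-cong (ℚ.toℚᵘ-fromℚᵘ (mkℚᵘ (ℤ.+ a) b)) (ℚ.toℚᵘ-fromℚᵘ (mkℚᵘ (ℤ.+ c) b)))
  (ℚᵘ.≃-trans (*≡* eq) (ℚᵘ.≃-sym (ℚ.toℚᵘ-fromℚᵘ (mkℚᵘ (ℤ.+ (a + c)) b))))))
  where
  lemma : ∀ x y z → (x ℤ.* z ℤ.+ y ℤ.* z) ℤ.* z ≡ (x ℤ.+ y) ℤ.* (z ℤ.* z)
  lemma = ℤ-solve-∀
  eq : (ℤ.+ a ℤ.* ℤ.+ suc b ℤ.+ ℤ.+ c ℤ.* ℤ.+ suc b) ℤ.* ℤ.+ suc b ≡ ℤ.+ (a + c) ℤ.* (ℤ.+ suc b ℤ.* ℤ.+ suc b)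
  eq = lemma (ℤ.+ a) (ℤ.+ c) (ℤ.+ suc b)

·ℚ-/ : ∀ n a b .{{_ : NonZero b}} → n ·ℚ (ℤ.+ a ℚ./ b) ≡ ℤ.+ (n * a) ℚ./ b
·ℚ-/ zero    a b = sym (ℚ.0/n≡0 b)
·ℚ-/ (suc n) a b = trans (cong (ℤ.+ a ℚ./ b ℚ.+_) (·ℚ-/ n a b)) (+-/ a (n * a) b)

·ℚ-* : ∀ n x → n ·ℚ x ≡ (ℤ.+ n ℚ./ 1) ℚ.* x
·ℚ-* zero    x = sym (ℚ.*-zeroˡ x)
·ℚ-* (suc n) x = begin
  x ℚ.+ n ·ℚ x ≡⟨ cong₂ ℚ._+_ (sym (ℚ.*-identityˡ x)) (·ℚ-* n x) ⟩
  ℚ.1ℚ ℚ.* x ℚ.+ (ℤ.+ n ℚ./ 1) ℚ.* x ≡⟨ ℚ.*-distribʳ-+ x ℚ.1ℚ (ℤ.+ n ℚ./ 1) ⟨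
  (ℚ.1ℚ ℚ.+ ℤ.+ n ℚ./ 1) ℚ.* x ≡⟨ cong (ℚ._* x) (+-/ 1 n 1) ⟩
  (ℤ.+ suc n ℚ./ 1) ℚ.* x ∎

·ℚ-cancelˡ : ∀ n .{{_ : NonZero n}} {x y} → n ·ℚ x ≡ n ·ℚ y → x ≡ y
-- A positive factor can be cancelled from ≤; doing so in both directions gives the equality.
·ℚ-cancelˡ (suc n) {x} {y} eq = ℚ.≤-antisym (cancel (ℚ.≤-reflexive eq′)) (cancel (ℚ.≤-reflexive (sym eq′)))
  where
  eq′ = trans (sym (·ℚ-* (suc n) x)) (trans eq (·ℚ-* (suc n) y))
  cancel : ∀ {u v} → (ℤ.+ suc n ℚ./ 1) ℚ.* u ℚ.≤ (ℤ.+ suc n ℚ./ 1) ℚ.* v → u ℚ.≤ v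
  cancel = ℚ.*-cancelˡ-≤-pos (ℤ.+ suc n ℚ./ 1) {{ℚ.normalize-pos (suc n) 1}}

∑-/1 : ∀ {A : Set} (xs : List A) (f : A → ℕ) → ∑ℚ.∑ xs (λ x → ℤ.+ f x ℚ./ 1) ≡ ℤ.+ ∑ xs f ℚ./ 1
∑-/1 []       f = refl
∑-/1 (x ∷ xs) f = trans (cong (ℤ.+ f x ℚ./ 1 ℚ.+_) (∑-/1 xs f)) (+-/ (f x) (∑ xs f) 1)

weight : List ℕ → ℚ
weight μ = (ℤ.+ σ-parts μ ℚ./ z μ) {{z≢0 μ}}

-- The factor k (m_k(μ) + 1) is exactly what `z` gains from the insertion, and `σ k` is what
-- `σ-parts` gains.
weight-insert : ∀ {k} μ → 1 ≤ k → k ·ℚ (suc (mult k μ) ·ℚ weight (insert k μ)) ≡ σ k ·ℚ weight μ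
weight-insert {k} μ 1≤k = begin
  k ·ℚ (m ·ℚ weight ν) ≡⟨ ·ℚ-assocˡ (weight ν) k m ⟩
  (k * m) ·ℚ weight ν ≡⟨ ·ℚ-/ (k * m) (σ-parts ν) (z ν) {{z≢0 ν}} ⟩
  (ℤ.+ (k * m * σ-parts ν) ℚ./ z ν) {{z≢0 ν}}
    ≡⟨ /-cross (k * m * σ-parts ν) (z ν) (σ k * σ-parts μ) (z μ) {{z≢0 ν}} {{z≢0 μ}} cross ⟩
  (ℤ.+ (σ k * σ-parts μ) ℚ./ z μ) {{z≢0 μ}} ≡⟨ ·ℚ-/ (σ k) (σ-parts μ) (z μ) {{z≢0 μ}} ⟨
  σ k ·ℚ weight μ ∎
  where
  ν = insert k μ
  m = suc (mult k μ)
  regroup : ∀ a b c → a * b * c ≡ b * (a * c)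
  regroup = solve-∀
  cross : k * m * σ-parts ν * z μ ≡ σ k * σ-parts μ * z ν
  cross = begin
    k * m * σ-parts ν * z μ ≡⟨ regroup (k * m) (σ-parts ν) (z μ) ⟩
    σ-parts ν * (k * m * z μ) ≡⟨ cong₂ _*_ (σ-parts-insert k μ) (sym (z-insert μ 1≤k)) ⟩
    σ k * σ-parts μ * z ν ∎

totalWeight : ℕ → ℚ
totalWeight n = ∑ℚ.∑ (partitions n) weight

n·totalWeight : ∀ n → n ·ℚ totalWeight n ≡ ∑ℚ.∑ [1⋯ n ] (λ k → σ k ·ℚ totalWeight (n ∸ k))
n·totalWeight n = trans (Pℚ.·-∑-partitions n weight) (∑ℚ.∑-cong [1⋯ n ] λ k∈ →
  let 1≤k , k≤n = ∈-[1⋯]⁻ k∈ in term 1≤k k≤n)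
  where
  term : ∀ {k} → 1 ≤ k → k ≤ n →
    k ·ℚ ∑ℚ.∑ (partitions n) (λ μ → mult k μ ·ℚ weight μ) ≡ σ k ·ℚ totalWeight (n ∸ k)
  term {k} 1≤k k≤n = begin
    k ·ℚ ∑ℚ.∑ (partitions n) (λ μ → mult k μ ·ℚ weight μ)
      -- Since k ≤ n, writing n as `k + (n ∸ k)` brings the sum into the form of `∑-mult-insert`.
      ≡⟨ cong (λ m → k ·ℚ ∑ℚ.∑ (partitions m) (λ μ → mult k μ ·ℚ weight μ)) (m+[n∸m]≡n k≤n) ⟨
    k ·ℚ ∑ℚ.∑ (partitions (k + (n ∸ k))) (λ μ → mult k μ ·ℚ weight μ)
      ≡⟨ cong (k ·ℚ_) (Pℚ.∑-mult-insert (n ∸ k) weight 1≤k) ⟩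
    k ·ℚ ∑ℚ.∑ (partitions (n ∸ k)) (λ μ → suc (mult k μ) ·ℚ weight (insert k μ))
      ≡⟨ ∑ℚ.∑-· k (partitions (n ∸ k)) _ ⟨
    ∑ℚ.∑ (partitions (n ∸ k)) (λ μ → k ·ℚ (suc (mult k μ) ·ℚ weight (insert k μ)))
      ≡⟨ ∑ℚ.∑-cong (partitions (n ∸ k)) (λ {μ} _ → weight-insert μ 1≤k) ⟩
    ∑ℚ.∑ (partitions (n ∸ k)) (λ μ → σ k ·ℚ weight μ) ≡⟨ ∑ℚ.∑-· (σ k) (partitions (n ∸ k)) weight ⟩
    σ k ·ℚ totalWeight (n ∸ k) ∎

p≡totalWeight : ∀ n → ℤ.+ p n ℚ./ 1 ≡ totalWeight n
p≡totalWeight = <-rec _ go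
  where
  go : ∀ n → (∀ {m} → m < n → ℤ.+ p m ℚ./ 1 ≡ totalWeight m) → ℤ.+ p n ℚ./ 1 ≡ totalWeight n
  -- Both sides compute to 1: the empty list is the only partition of 0, and its weight is a
  -- quotient of empty products.
  go zero      rec = refl
  go n@(suc _) rec = ·ℚ-cancelˡ n (begin
    n ·ℚ (ℤ.+ p n ℚ./ 1) ≡⟨ ·ℚ-/ n (p n) 1 ⟩
    ℤ.+ (n * p n) ℚ./ 1 ≡⟨ cong (λ x → ℤ.+ x ℚ./ 1) (n*p≡∑σ*p n) ⟩
    ℤ.+ ∑ [1⋯ n ] (λ k → σ k * p (n ∸ k)) ℚ./ 1 ≡⟨ ∑-/1 [1⋯ n ] (λ k → σ k * p (n ∸ k)) ⟨
    ∑ℚ.∑ [1⋯ n ] (λ k → ℤ.+ (σ k * p (n ∸ k)) ℚ./ 1) ≡⟨ ∑ℚ.∑-cong [1⋯ n ] (λ {k} k∈ →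
      let 1≤k , k≤n = ∈-[1⋯]⁻ k∈ in trans (sym (·ℚ-/ (σ k) (p (n ∸ k)) 1))
        (cong (σ k ·ℚ_) (rec (∸-monoʳ-< 1≤k k≤n)))) ⟩
    ∑ℚ.∑ [1⋯ n ] (λ k → σ k ·ℚ totalWeight (n ∸ k)) ≡⟨ n·totalWeight n ⟨
    n ·ℚ totalWeight n ∎)

det-cong : ∀ {n} (M N : Matrix n) → (∀ r c → M r c ≡ N r c) → det M ≡ det N
det-cong {zero}  M N M≗N = refl
det-cong {suc n} M N M≗N = sum-cong-≗ λ k →
  cong₂ (λ x y → -1ℤ ℤ.^ toℕ k ℤ.* x ℤ.* y) (M≗N zero k) (det-cong _ _ λ r c → M≗N (suc r) (punchIn k c))

-- Hessenberg determinants

-- In withFirstColumn and the lemmas about it, rows and columns are numbered from 0.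

shifted : (ℕ → ℕ → ℤ) → ℕ → ℕ → ℤ
shifted a i k = a (suc i) (suc k)

-- The first column is kept apart from `a` because an elimination step rewrites this column and only
-- shifts the others.
withFirstColumn : (ℕ → ℤ) → (ℕ → ℕ → ℤ) → ∀ n → Matrix n
withFirstColumn x a n r zero    = x (toℕ r)
withFirstColumn x a n r (suc c) = a (toℕ r) (suc (toℕ c))

Hessenberg : (ℕ → ℕ → ℤ) → Set
Hessenberg a = ∀ {i k} → suc i < k → a i k ≡ 0ℤ

-- Beyond its first two entries the top row is zero. Deleting column 0 makes column 1 of `a` the
-- first column; deleting column 1 leaves the tail of `x` there. The other columns are those of
-- `shifted a` in both minors.
det-expand : ∀ {a} → Hessenberg a → ∀ x m →
  det (withFirstColumn x a (suc (suc m))) ≡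
  x 0 ℤ.* det (withFirstColumn (λ i → a (suc i) 1) (shifted a) (suc m))
  ℤ.- a 0 1 ℤ.* det (withFirstColumn (x ∘ suc) (shifted a) (suc m))
det-expand {a} hess x m = begin
  det M ≡⟨⟩
  1ℤ ℤ.* x 0 ℤ.* det (minor zero) ℤ.+ (-1ℤ ℤ.* a 0 1 ℤ.* det (minor (suc zero)) ℤ.+ Σᶠ term)
    ≡⟨ cong₂ (λ p q → 1ℤ ℤ.* x 0 ℤ.* p ℤ.+ q)
         (det-cong (minor zero) X₁ λ { r zero → refl ; r (suc c) → refl })
         (cong₂ (λ p q → -1ℤ ℤ.* a 0 1 ℤ.* p ℤ.+ q)
           (det-cong (minor (suc zero)) X₂ λ { r zero → refl ; r (suc c) → refl })
           (trans (sum-cong-≗ vanish) (sum-replicate-zero m))) ⟩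
  1ℤ ℤ.* x 0 ℤ.* det X₁ ℤ.+ (-1ℤ ℤ.* a 0 1 ℤ.* det X₂ ℤ.+ 0ℤ) ≡⟨ signs (x 0) (a 0 1) (det X₁) (det X₂) ⟩
  x 0 ℤ.* det X₁ ℤ.- a 0 1 ℤ.* det X₂ ∎
  where
  M = withFirstColumn x a (suc (suc m))
  minor : Fin (suc (suc m)) → Matrix (suc m)
  minor k r c = M (suc r) (punchIn k c)
  X₁ = withFirstColumn (λ i → a (suc i) 1) (shifted a) (suc m)
  X₂ = withFirstColumn (x ∘ suc) (shifted a) (suc m)
  term : Fin m → ℤ
  term k = -1ℤ ℤ.^ toℕ (suc (suc k)) ℤ.* a 0 (suc (suc (toℕ k))) ℤ.* det (minor (suc (suc k)))
  kill : ∀ s d → s ℤ.* 0ℤ ℤ.* d ≡ 0ℤ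
  kill = ℤ-solve-∀
  vanish : ∀ k → term k ≡ 0ℤ
  vanish k rewrite hess {0} {suc (suc (toℕ k))} (s<s z<s) =
    kill (-1ℤ ℤ.^ toℕ (suc (suc k))) (det (minor (suc (suc k))))
  signs : ∀ u v p q → 1ℤ ℤ.* u ℤ.* p ℤ.+ (-1ℤ ℤ.* v ℤ.* q ℤ.+ 0ℤ) ≡ u ℤ.* p ℤ.- v ℤ.* q
  signs = ℤ-solve-∀

-- In the expansion the first minor is independent of the first column, and the second minor has the
-- tail of that column as its own first column, so induction on the size applies.
det-linear : ∀ {a} → Hessenberg a → ∀ m α β x y →
  det (withFirstColumn (λ i → α ℤ.* x i ℤ.- β ℤ.* y i) a (suc m)) ≡
  α ℤ.* det (withFirstColumn x a (suc m)) ℤ.- β ℤ.* det (withFirstColumn y a (suc m))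
det-linear hess zero α β x y = lemma α β (x 0) (y 0)
  where
  lemma : ∀ α β u v → 1ℤ ℤ.* (α ℤ.* u ℤ.- β ℤ.* v) ℤ.* 1ℤ ℤ.+ 0ℤ ≡
                      α ℤ.* (1ℤ ℤ.* u ℤ.* 1ℤ ℤ.+ 0ℤ) ℤ.- β ℤ.* (1ℤ ℤ.* v ℤ.* 1ℤ ℤ.+ 0ℤ)
  lemma = ℤ-solve-∀
det-linear {a} hess (suc m) α β x y = begin
  det (withFirstColumn (λ i → α ℤ.* x i ℤ.- β ℤ.* y i) a (suc (suc m)))
    ≡⟨ det-expand hess (λ i → α ℤ.* x i ℤ.- β ℤ.* y i) m ⟩
  (α ℤ.* x 0 ℤ.- β ℤ.* y 0) ℤ.* D
    ℤ.- a 0 1 ℤ.* det (withFirstColumn (λ i → α ℤ.* x (suc i) ℤ.- β ℤ.* y (suc i)) (shifted a) (suc m))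
    ≡⟨ cong (λ d → (α ℤ.* x 0 ℤ.- β ℤ.* y 0) ℤ.* D ℤ.- a 0 1 ℤ.* d)
         (det-linear (hess ∘ s<s) m α β (x ∘ suc) (y ∘ suc)) ⟩
  (α ℤ.* x 0 ℤ.- β ℤ.* y 0) ℤ.* D ℤ.- a 0 1 ℤ.* (α ℤ.* det X ℤ.- β ℤ.* det Y)
    ≡⟨ lemma α β (x 0) (y 0) (a 0 1) D (det X) (det Y) ⟩
  α ℤ.* (x 0 ℤ.* D ℤ.- a 0 1 ℤ.* det X) ℤ.- β ℤ.* (y 0 ℤ.* D ℤ.- a 0 1 ℤ.* det Y)
    ≡⟨ cong₂ (λ p q → α ℤ.* p ℤ.- β ℤ.* q) (det-expand hess x m) (det-expand hess y m) ⟨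
  α ℤ.* det (withFirstColumn x a (suc (suc m))) ℤ.- β ℤ.* det (withFirstColumn y a (suc (suc m))) ∎
  where
  D = det (withFirstColumn (λ i → a (suc i) 1) (shifted a) (suc m))
  X = withFirstColumn (x ∘ suc) (shifted a) (suc m)
  Y = withFirstColumn (y ∘ suc) (shifted a) (suc m)
  lemma : ∀ α β u v b d p q →
    (α ℤ.* u ℤ.- β ℤ.* v) ℤ.* d ℤ.- b ℤ.* (α ℤ.* p ℤ.- β ℤ.* q) ≡
    α ℤ.* (u ℤ.* d ℤ.- b ℤ.* p) ℤ.- β ℤ.* (v ℤ.* d ℤ.- b ℤ.* q)
  lemma = ℤ-solve-∀

-- V r is the first column after r eliminations; its entries above row r are arbitrary.
det-Hessenberg : ∀ {a} → Hessenberg a → (V : ℕ → ℕ → ℤ) →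
  (∀ {r i} → r ≤ i → V (suc r) (suc i) ≡ V r r ℤ.* a (suc i) (suc r) ℤ.- a r (suc r) ℤ.* V r (suc i)) →
  ∀ m → det (withFirstColumn (V 0) a (suc m)) ≡ V m m
det-Hessenberg hess V step zero = lemma (V 0 0)
  where
  lemma : ∀ x → 1ℤ ℤ.* x ℤ.* 1ℤ ℤ.+ 0ℤ ≡ x
  lemma = ℤ-solve-∀
det-Hessenberg {a} hess V step (suc m) = begin
  det (withFirstColumn (V 0) a (suc (suc m))) ≡⟨ det-expand hess (V 0) m ⟩
  V 0 0 ℤ.* det (withFirstColumn (λ i → a (suc i) 1) (shifted a) (suc m))
    ℤ.- a 0 1 ℤ.* det (withFirstColumn (V 0 ∘ suc) (shifted a) (suc m))
    -- The two minors differ only in their first columns, so linearity merges them into a single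
    -- determinant.
    ≡⟨ det-linear {shifted a} (hess ∘ s<s) m (V 0 0) (a 0 1) (λ i → a (suc i) 1) (V 0 ∘ suc) ⟨
  det merged
    ≡⟨ det-cong (withFirstColumn (V 1 ∘ suc) (shifted a) (suc m)) merged
         (λ { r zero → step z≤n ; r (suc c) → refl }) ⟨
  det (withFirstColumn (V 1 ∘ suc) (shifted a) (suc m))
    -- The eliminations still to come are those of the smaller matrix, whose columns are given by
    -- `V` shifted in both indices.
    ≡⟨ det-Hessenberg {shifted a} (hess ∘ s<s) (shifted V) (step ∘ s≤s) m ⟩
  V (suc m) (suc m) ∎
  where
  merged = withFirstColumn (λ i → V 0 0 ℤ.* a (suc i) 1 ℤ.- a 0 1 ℤ.* V 0 (suc i)) (shifted a) (suc m)

-- The determinants of J and H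

≤⇒≤ᵇ≡true : ∀ {m n} → m ≤ n → (m ≤ᵇ n) ≡ true
≤⇒≤ᵇ≡true = Equivalence.to T-≡ ∘ ≤⇒≤ᵇ

>⇒≤ᵇ≡false : ∀ {m n} → n < m → (m ≤ᵇ n) ≡ false
>⇒≤ᵇ≡false {m} {n} n<m with m ≤ᵇ n | ≤ᵇ⇒≤ m n
... | false | _   = refl
... | true  | m≤n = contradiction (m≤n tt) (<⇒≱ n<m)

≢⇒≡ᵇ≡false : ∀ {m n} → m ≢ n → (m ≡ᵇ n) ≡ false
≢⇒≡ᵇ≡false {m} {n} m≢n with m ≡ᵇ n | ≡ᵇ⇒≡ m n
... | false | _   = refl
... | true  | m≡n = contradiction (m≡n tt) m≢n

≡ᵇ-refl : ∀ n → (n ≡ᵇ n) ≡ true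
≡ᵇ-refl n = Equivalence.to T-≡ (≡⇒≡ᵇ n n refl)

J-lower : ∀ j {i k} → k ≤ i → J-entry j i k ≡ j (suc (i ∸ k))
J-lower j k≤i rewrite ≤⇒≤ᵇ≡true k≤i = refl

J-super : ∀ j i → J-entry j i (suc i) ≡ ℤ.- (ℤ.+ i)
J-super j i rewrite >⇒≤ᵇ≡false (n<1+n i) | ≡ᵇ-refl i = refl

J-zero : ∀ j {i k} → suc i < k → J-entry j i k ≡ 0ℤ
J-zero j {i} 1+i<k rewrite >⇒≤ᵇ≡false (<⇒≤ 1+i<k) | ≢⇒≡ᵇ≡false (>⇒≢ 1+i<k) = refl

-- The column is written `suc (suc k)` so that the test for the special first column computes to
-- false.
H-lower : ∀ h {i k} → suc (suc k) ≤ i → H-entry h i (suc (suc k)) ≡ h (suc (i ∸ suc (suc k)))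
H-lower h k≤i rewrite ≤⇒≤ᵇ≡true k≤i = refl

H-super : ∀ h i → H-entry h (suc i) (suc (suc i)) ≡ 1ℤ
H-super h i rewrite >⇒≤ᵇ≡false (n<1+n (suc i)) | ≡ᵇ-refl i = refl

H-zero : ∀ h {i k} → suc i < k → H-entry h i k ≡ 0ℤ
H-zero h {i} {suc zero} (s≤s ())
H-zero h {i} {suc (suc k)} 1+i<k rewrite >⇒≤ᵇ≡false (<⇒≤ 1+i<k) | ≢⇒≡ᵇ≡false (>⇒≢ 1+i<k) = refl

-- Passes from the 1-based entry formulas to the 0-based convention of `det-Hessenberg`, with
-- `shifted a` doing the change of index.
det-fromEntries : ∀ a (V : ℕ → ℕ → ℤ) →
  (∀ {i k} → suc i < k → a i k ≡ 0ℤ) →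
  (∀ i → V 0 i ≡ a (suc i) 1) →
  (∀ {r i} → r ≤ i → V (suc r) (suc i) ≡
    V r r ℤ.* a (suc (suc i)) (suc (suc r)) ℤ.- a (suc r) (suc (suc r)) ℤ.* V r (suc i)) →
  ∀ m → det (fromEntries a (suc m)) ≡ V m m
det-fromEntries a V hess V₀ step m = trans
  (det-cong (fromEntries a (suc m)) (withFirstColumn (V 0) (shifted a) (suc m))
    λ { r zero → sym (V₀ (toℕ r)) ; r (suc c) → refl })
  (det-Hessenberg {shifted a} (hess ∘ s≤s) V step m)

-- The first column of J after r eliminations, divided by r!; `suc i` is the 1-based number of row
-- i.
∑p*σ : ℕ → ℕ → ℕ
∑p*σ r i = ∑ (upTo (suc r)) λ s → p s * σ (suc i ∸ s)

∑p*σ-diagonal : ∀ r → ∑p*σ r r ≡ suc r * p (suc r)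
∑p*σ-diagonal r = begin
  ∑ (upTo (suc r)) (λ s → p s * σ (suc r ∸ s))
    -- Since s ≤ r, s equals `suc r ∸ (suc r ∸ s)`; the summand thus depends only on d =
    -- `suc r ∸ s`, and reversing the order yields the recurrence.
    ≡⟨ ∑ℕ.∑-cong (upTo (suc r)) (λ {s} s∈ → trans (*-comm (p s) _)
         (cong (λ t → σ (suc r ∸ s) * p t) (sym (m∸[m∸n]≡n (<⇒≤ (∈-upTo⁻ s∈)))))) ⟩
  ∑ (upTo (suc r)) (λ s → σ (suc r ∸ s) * p (suc r ∸ (suc r ∸ s)))
    ≡⟨ ∑ℕ.∑-reverse (suc r) (λ d → σ d * p (suc r ∸ d)) ⟩
  ∑ [1⋯ suc r ] (λ d → σ d * p (suc r ∸ d)) ≡⟨ n*p≡∑σ*p (suc r) ⟨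
  suc r * p (suc r) ∎

det-J : ∀ m → det (J (suc m) (ℤ.+_ ∘ σ)) ≡ ℤ.+ (suc m ! * p (suc m))
det-J m = trans (det-fromEntries (J-entry (ℤ.+_ ∘ σ)) V (J-zero (ℤ.+_ ∘ σ)) V₀ step m) (cong ℤ.+_ (diagonal m))
  where
  V : ℕ → ℕ → ℤ
  V r i = ℤ.+ (r ! * ∑p*σ r i)
  V₀ : ∀ i → V 0 i ≡ ℤ.+ σ (suc i)
  V₀ i = cong ℤ.+_ (lemma (σ (suc i)))
    where
    lemma : ∀ x → 1 * (1 * x + 0) ≡ x
    lemma = solve-∀
  diagonal : ∀ r → r ! * ∑p*σ r r ≡ suc r ! * p (suc r)
  diagonal r = trans (cong (r ! *_) (∑p*σ-diagonal r)) (lemma (r !) (suc r) (p (suc r)))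
    where
    lemma : ∀ x y z → x * (y * z) ≡ y * x * z
    lemma = solve-∀
  step : ∀ {r i} → r ≤ i → V (suc r) (suc i) ≡
    V r r ℤ.* J-entry (ℤ.+_ ∘ σ) (suc (suc i)) (suc (suc r))
      ℤ.- J-entry (ℤ.+_ ∘ σ) (suc r) (suc (suc r)) ℤ.* V r (suc i)
  step {r} {i} r≤i = begin
    ℤ.+ (suc r ! * ∑p*σ (suc r) (suc i))
      ≡⟨ cong (λ x → ℤ.+ (suc r ! * x)) (∑ℕ.∑-suc-upTo (suc r) (λ s → p s * σ (suc (suc i) ∸ s))) ⟩
    ℤ.+ (suc r ! * (∑p*σ r (suc i) + p (suc r) * σ (suc i ∸ r)))
      ≡⟨ cong ℤ.+_ (expand (suc r) (r !) (∑p*σ r (suc i)) (p (suc r)) (σ (suc i ∸ r))) ⟩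
    ℤ.+ (suc r ! * p (suc r) * σ (suc i ∸ r) + suc r * (r ! * ∑p*σ r (suc i)))
      -- The new term s = r + 1 carries (r+1)! p(r+1), which `diagonal` recognises as the pivot
      -- `V r r`; r ≤ i turns the argument of `σ` into that of the entry of J.
      ≡⟨ cong₂ (λ x y → ℤ.+ (x * σ y + suc r * (r ! * ∑p*σ r (suc i)))) (sym (diagonal r)) (+-∸-assoc 1 r≤i) ⟩
    ℤ.+ (r ! * ∑p*σ r r * σ (suc (i ∸ r)) + suc r * (r ! * ∑p*σ r (suc i)))
      ≡⟨ cong₂ ℤ._+_ (ℤ.pos-* (r ! * ∑p*σ r r) _) (ℤ.pos-* (suc r) _) ⟩
    V r r ℤ.* ℤ.+ σ (suc (i ∸ r)) ℤ.+ ℤ.+ suc r ℤ.* V r (suc i)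
      ≡⟨ signs (V r r ℤ.* ℤ.+ σ (suc (i ∸ r))) (ℤ.+ suc r) (V r (suc i)) ⟩
    V r r ℤ.* ℤ.+ σ (suc (i ∸ r)) ℤ.- ℤ.- ℤ.+ suc r ℤ.* V r (suc i)
      ≡⟨ cong₂ (λ x y → V r r ℤ.* x ℤ.- y ℤ.* V r (suc i))
           (J-lower (ℤ.+_ ∘ σ) (s≤s (s≤s r≤i))) (J-super (ℤ.+_ ∘ σ) (suc r)) ⟨
    V r r ℤ.* J-entry (ℤ.+_ ∘ σ) (suc (suc i)) (suc (suc r))
      ℤ.- J-entry (ℤ.+_ ∘ σ) (suc r) (suc (suc r)) ℤ.* V r (suc i) ∎
    where
    expand : ∀ a b c d e → a * b * (c + d * e) ≡ a * b * d * e + a * (b * c)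
    expand = solve-∀
    signs : ∀ a b c → a ℤ.+ b ℤ.* c ≡ a ℤ.- ℤ.- b ℤ.* c
    signs = ℤ-solve-∀

^-1-involutive : ∀ m x → -1ℤ ℤ.^ m ℤ.* (-1ℤ ℤ.^ m ℤ.* x) ≡ x
^-1-involutive zero    x = trans (ℤ.*-identityˡ _) (ℤ.*-identityˡ x)
^-1-involutive (suc m) x = trans (lemma (-1ℤ ℤ.^ m) x) (^-1-involutive m x)
  where
  lemma : ∀ s x → -1ℤ ℤ.* s ℤ.* (-1ℤ ℤ.* s ℤ.* x) ≡ s ℤ.* (s ℤ.* x)
  lemma = ℤ-solve-∀

-- The sum of σ d * p (suc i ∸ d) over r < d ≤ suc i, written as a difference so that tail-σ*p-suc needs
-- no bound on r.
tail-σ*p : ℕ → ℕ → ℤ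
tail-σ*p r i = ℤ.+ (suc i * p (suc i)) ℤ.- ℤ.+ ∑ [1⋯ r ] λ d → σ d * p (suc i ∸ d)

tail-σ*p-suc : ∀ r i → tail-σ*p (suc r) i ≡ tail-σ*p r i ℤ.- ℤ.+ (σ (suc r) * p (i ∸ r))
tail-σ*p-suc r i = trans
  (cong (λ x → ℤ.+ (suc i * p (suc i)) ℤ.- ℤ.+ x) (∑ℕ.∑-suc r (λ d → σ d * p (suc i ∸ d))))
  (lemma (ℤ.+ (suc i * p (suc i))) (ℤ.+ ∑ [1⋯ r ] (λ d → σ d * p (suc i ∸ d))) _)
  where
  lemma : ∀ a b c → a ℤ.- (b ℤ.+ c) ≡ a ℤ.- b ℤ.- c
  lemma = ℤ-solve-∀

-- By the recurrence for p at r + 1, everything cancels but the term d = r + 1, where `p (r ∸ r)` is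
-- p(0) = 1.
tail-σ*p-diagonal : ∀ r → tail-σ*p r r ≡ ℤ.+ σ (suc r)
tail-σ*p-diagonal r = begin
  ℤ.+ (suc r * p (suc r)) ℤ.- ℤ.+ s ≡⟨ cong (λ x → ℤ.+ x ℤ.- ℤ.+ s) (trans (n*p≡∑σ*p (suc r)) (∑ℕ.∑-suc r f)) ⟩
  ℤ.+ s ℤ.+ ℤ.+ (σ (suc r) * p (r ∸ r)) ℤ.- ℤ.+ s ≡⟨ lemma (ℤ.+ s) _ ⟩
  ℤ.+ (σ (suc r) * p (r ∸ r)) ≡⟨ cong ℤ.+_ (trans (cong (λ t → σ (suc r) * p t) (n∸n≡0 r)) (*-identityʳ _)) ⟩
  ℤ.+ σ (suc r) ∎
  where
  f : ℕ → ℕ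
  f d = σ d * p (suc r ∸ d)
  s = ∑ [1⋯ r ] f
  lemma : ∀ a b → a ℤ.+ b ℤ.- a ≡ b
  lemma = ℤ-solve-∀

det-H : ∀ m → det (H (suc m) (ℤ.+_ ∘ p)) ≡ -1ℤ ℤ.^ m ℤ.* ℤ.+ σ (suc m)
det-H m = trans (det-fromEntries (H-entry (ℤ.+_ ∘ p)) V (H-zero (ℤ.+_ ∘ p)) V₀ step m) (diagonal m)
  where
  V : ℕ → ℕ → ℤ
  V r i = -1ℤ ℤ.^ r ℤ.* tail-σ*p r i
  diagonal : ∀ r → V r r ≡ -1ℤ ℤ.^ r ℤ.* ℤ.+ σ (suc r)
  diagonal r = cong (-1ℤ ℤ.^ r ℤ.*_) (tail-σ*p-diagonal r)
  V₀ : ∀ i → V 0 i ≡ ℤ.+ suc i ℤ.* ℤ.+ p (suc i)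
  V₀ i = trans (lemma (ℤ.+ (suc i * p (suc i)))) (ℤ.pos-* (suc i) (p (suc i)))
    where
    lemma : ∀ x → 1ℤ ℤ.* (x ℤ.- 0ℤ) ≡ x
    lemma = ℤ-solve-∀
  step : ∀ {r i} → r ≤ i → V (suc r) (suc i) ≡
    V r r ℤ.* H-entry (ℤ.+_ ∘ p) (suc (suc i)) (suc (suc r))
      ℤ.- H-entry (ℤ.+_ ∘ p) (suc r) (suc (suc r)) ℤ.* V r (suc i)
  step {r} {i} r≤i = begin
    -1ℤ ℤ.* -1ℤ ℤ.^ r ℤ.* tail-σ*p (suc r) (suc i)
      ≡⟨ cong (-1ℤ ℤ.* -1ℤ ℤ.^ r ℤ.*_) (trans (tail-σ*p-suc r (suc i))
           (cong (λ x → tail-σ*p r (suc i) ℤ.- x) (ℤ.pos-* (σ (suc r)) (p (suc i ∸ r))))) ⟩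
    -1ℤ ℤ.* -1ℤ ℤ.^ r ℤ.* (tail-σ*p r (suc i) ℤ.- ℤ.+ σ (suc r) ℤ.* ℤ.+ p (suc i ∸ r))
      ≡⟨ expand (-1ℤ ℤ.^ r) (tail-σ*p r (suc i)) (ℤ.+ σ (suc r)) (ℤ.+ p (suc i ∸ r)) ⟩
    -1ℤ ℤ.^ r ℤ.* ℤ.+ σ (suc r) ℤ.* ℤ.+ p (suc i ∸ r) ℤ.- 1ℤ ℤ.* V r (suc i)
      -- The signed `σ (suc r)` is the pivot `V r r`, and r ≤ i gives `p` the index found in the
      -- entry of H.
      ≡⟨ cong₂ (λ x k → x ℤ.* ℤ.+ p k ℤ.- 1ℤ ℤ.* V r (suc i)) (sym (diagonal r)) (+-∸-assoc 1 r≤i) ⟩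
    V r r ℤ.* ℤ.+ p (suc (i ∸ r)) ℤ.- 1ℤ ℤ.* V r (suc i)
      ≡⟨ cong₂ (λ x y → V r r ℤ.* x ℤ.- y ℤ.* V r (suc i))
           (H-lower (ℤ.+_ ∘ p) (s≤s (s≤s r≤i))) (H-super (ℤ.+_ ∘ p) r) ⟨
    V r r ℤ.* H-entry (ℤ.+_ ∘ p) (suc (suc i)) (suc (suc r))
      ℤ.- H-entry (ℤ.+_ ∘ p) (suc r) (suc (suc r)) ℤ.* V r (suc i) ∎
    where
    expand : ∀ s t a b → -1ℤ ℤ.* s ℤ.* (t ℤ.- a ℤ.* b) ≡ s ℤ.* a ℤ.* b ℤ.- 1ℤ ℤ.* (s ℤ.* t)
    expand = ℤ-solve-∀

theorem3p4 : ∀ (n : ℕ) → n ≥ 1 →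
    (ℤ.+ (n ! * p n) ≡ det (J n (λ i → ℤ.+ σ i)))
    × (ℤ.+ σ n ≡ -1ℤ ℤ.^ (n ∸ 1) ℤ.* det (H n (λ i → ℤ.+ p i)))
    × (ℤ.+ p n ℚ./ 1 ≡ sumℚ (map (λ μ → (ℤ.+ σ-parts μ ℚ./ z μ) {{z≢0 μ}}) (partitions n)))
theorem3p4 (suc m) _ =
  sym (det-J m) ,
  -- The sign in front of the determinant cancels the one in `det-H`, because (-1)^m squares to 1.
  sym (trans (cong (-1ℤ ℤ.^ m ℤ.*_) (det-H m)) (^-1-involutive m (ℤ.+ σ (suc m)))) ,
  p≡totalWeight (suc m)
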